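{- Let $\mathcal F\subseteq\omega^\omega$ and let $\mathcal I,\mathcal J$ be ideals on $\omega$ such that $\mathcal I$ is tall and $\mathcal I\not\le_{\mathcal F}\mathcal J\restriction A$ for all $A\notin\mathcal J$. Then: (1) $\mathfrak p(\mathcal J)\le\mathfrak{fip}(\mathcal I,\mathcal J,\mathcal F)$; (2) $\operatorname{add}^*(\mathcal I)\le\mathfrak{fip}(\mathcal I,\mathcal J,\mathcal F)$.
   Context: An ideal on a set $X$ is a family of subsets of $X$ closed under finite unions and subsets, containing all finite subsets of $X$ and not containing $X$; $\mathcal J^+$ is the family of subsets of $X$ not in $\mathcal J$. $\mathcal I$ on $\omega$ is tall if every infinite $A\subseteq\omega$ contains an infinite $B\in\mathcal I$. For $A\notin\mathcal J$, $\mathcal J\restriction A=\{B\cap A:B\in\mathcal J\}$ (an ideal on $A$), and $\mathcal I\le_{\mathcal F}\mathcal J\restriction A$ means that there is $f\in\mathcal F$ with $f^{ -1}[B]\cap A\in\mathcal J$ for every $B\in\mathcal I$ (functions in $\mathcal F$ are restricted to $A$). A nonempty family $\mathcal A\subseteq\mathcal P(\omega)$ has $\mathcal J^+$-FIP if $\bigcap F\in\mathcal J^+$ for each finite $F\subseteq\mathcal A$. A set $B\in\mathcal J^+$ is a $\mathcal J^+$-pseudointersection of $\mathcal A$ if $B\setminus A\in\mathcal J$ for each $A\in\mathcal A$. With $\mathfrak c=2^{\aleph_0}$: $\mathfrak p(\mathcal J)=\min(\{|\mathcal A|:\mathcal A$ has $\mathcal J^+$-FIP but has no $\mathcal J^+$-pseudointersection$\}\cup\{\mathfrak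 c^+\})$; $\operatorname{add}^*(\mathcal I)=\min\{|\mathcal A|:\mathcal A\subseteq\mathcal I$ and there is no $B\in\mathcal I$ with $A\setminus B$ finite for all $A\in\mathcal A\}$ (well defined for tall $\mathcal I$); $\mathfrak{fip}(\mathcal I,\mathcal J,\mathcal F)$ is the minimum of the set consisting of $\mathfrak c^+$ and all cardinals $|\mathcal A|$ such that $\mathcal A\subseteq\mathcal P(\omega)$ has $\mathcal J^+$-FIP and it is not true that for every $f\in\mathcal F$ there is $B\in\mathcal I$ such that $\mathcal A\cup\{f^{ -1}[B]\}$ has $\mathcal J^+$-FIP. -}

module Defs where

open import Level using (Level; 0ℓ; _⊔_) renaming (suc to lsuc)
open import Data.Nat.Base using (ℕ)
open import Data.List.Base using (List; foldr)
open import Data.List.Membership.Propositional renaming (_∈_ to _∈ₗ_) using ()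
open import Data.List.Relation.Unary.All using (All)
open import Data.Product.Base using (Σ; _×_; ∃-syntax; proj₁)
open import Data.Sum.Base using (_⊎_)
open import Function.Bundles using (Func; Injection; Inverse)
open import Relation.Binary.Bundles using (Setoid)
open import Relation.Binary.Core using (REL)
open import Relation.Nullary.Negation.Core using (¬_)
open import Relation.Unary
  using (Pred; _∈_; _∉_; _⊆_; _≐_; _∩_; _∪_; _∖_; _⊢_; U; Satisfiable)
open import Relation.Unary.Relation.Binary.Equality using (≐-setoid)
import Relation.Binary.Construct.On as On

-- Zermelo–Fraenkel sets with choice are modelled by setoids.  Since an Agda
-- existential carries a witness, the content of this axiom is that the choice
-- can be made to respect the equalities of S and T.

AxiomOfChoice : (a ℓ r : Level) → Set (lsuc (a ⊔ ℓ ⊔ r))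
AxiomOfChoice a ℓ r =
  (S T : Setoid a ℓ) →
  let module S = Setoid S ; module T = Setoid T in
  (R : REL S.Carrier T.Carrier r) →
  (∀ {x x′ y y′} → x S.≈ x′ → y T.≈ y′ → R x y → R x′ y′) →
  (∀ x → ∃[ y ] R x y) →
  Σ (Func S T) λ f → ∀ x → R x (Func.to f x)

-- Subsets of ω, compared by extensional equality _≐_.

Subset : Set₁
Subset = Pred ℕ 0ℓ

-- Families of subsets of ω.  A family need not be closed under _≐_; it then
-- stands for its closure, and every notion below depends only on the closure.

Family : Set₂
Family = Pred Subset (lsuc 0ℓ)

Finite : Subset → Set
Finite A = ∃[ xs ] A ≐ (_∈ₗ xs)

Infinite : Subset → Set
Infinite A = ¬ Finite A

record IsIdeal (𝒥 : Family) : Set₁ where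
  field
    ∪-closed : ∀ {A B} → A ∈ 𝒥 → B ∈ 𝒥 → A ∪ B ∈ 𝒥
    ⊆-closed : ∀ {A B} → A ⊆ B → B ∈ 𝒥 → A ∈ 𝒥
    finite∈  : ∀ {A} → Finite A → A ∈ 𝒥
    ω∉       : U ∉ 𝒥

Tall : Family → Set₁
Tall ℐ = ∀ A → Infinite A → ∃[ B ] B ⊆ A × Infinite B × B ∈ ℐ

infix 4 _≤[_]_↾_

_≤[_]_↾_ : Family → Pred (ℕ → ℕ) (lsuc 0ℓ) → Family → Subset → Set₁
ℐ ≤[ ℱ ] 𝒥 ↾ A = ∃[ f ] f ∈ ℱ × (∀ B → B ∈ ℐ → (f ⊢ B) ∩ A ∈ 𝒥)

-- Intersection of a finite family, listed with possible repetitions; the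
-- empty intersection is ω.

⋂ₗ : List Subset → Subset
⋂ₗ = foldr _∩_ U

_⁺-FIP : Family → Family → Set₁
(𝒥 ⁺-FIP) 𝒜 = Satisfiable 𝒜 × (∀ As → All 𝒜 As → ⋂ₗ As ∉ 𝒥)

_⁺-Pseudointersection_ : Family → Family → Subset → Set₁
(𝒥 ⁺-Pseudointersection 𝒜) B = B ∉ 𝒥 × (∀ A → A ∈ 𝒜 → B ∖ A ∈ 𝒥)

-- Cardinals are represented by setoids, with two setoids representing the
-- same cardinal when they are in bijection.

Cardinal : Set₂
Cardinal = Setoid (lsuc 0ℓ) 0ℓ

infix 4 _≤ᶜ_ _<ᶜ_ _≈ᶜ_

_≤ᶜ_ _<ᶜ_ _≈ᶜ_ : Cardinal → Cardinal → Set₁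
κ ≤ᶜ μ = Injection κ μ
κ <ᶜ μ = κ ≤ᶜ μ × ¬ (μ ≤ᶜ κ)
κ ≈ᶜ μ = Inverse κ μ

𝔠 : Cardinal
𝔠 = ≐-setoid ℕ 0ℓ

∣_∣ : Family → Cardinal
∣ 𝒜 ∣ = On.setoid {B = Σ Subset 𝒜} 𝔠 proj₁

_IsSuccessorOf_ : Cardinal → Cardinal → Set₂
κ IsSuccessorOf μ = μ <ᶜ κ × (∀ ν → μ <ᶜ ν → κ ≤ᶜ ν)

_IsMinimumOf_ : Cardinal → Pred Cardinal (lsuc (lsuc 0ℓ)) → Set₂
κ IsMinimumOf S = κ ∈ S × (∀ μ → μ ∈ S → κ ≤ᶜ μ)

-- The cardinal characteristics are given as relations: "κ Is𝔭 𝒥" says that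
-- κ represents the cardinal 𝔭(𝒥), and similarly for the other two.

_Is𝔭_ : Cardinal → Family → Set₂
κ Is𝔭 𝒥 = κ IsMinimumOf λ μ →
  (∃[ 𝒜 ] μ ≈ᶜ ∣ 𝒜 ∣ × (𝒥 ⁺-FIP) 𝒜 × ¬ Satisfiable (𝒥 ⁺-Pseudointersection 𝒜))
  ⊎ μ IsSuccessorOf 𝔠

_IsAdd*_ : Cardinal → Family → Set₂
κ IsAdd* ℐ = κ IsMinimumOf λ μ →
  ∃[ 𝒜 ] μ ≈ᶜ ∣ 𝒜 ∣ × 𝒜 ⊆ ℐ ×
    ¬ (∃[ B ] B ∈ ℐ × (∀ A → A ∈ 𝒜 → Finite (A ∖ B)))

_Is𝔣𝔦𝔭⟨_,_,_⟩ : Cardinal → Family → Family → Pred (ℕ → ℕ) (lsuc 0ℓ) → Set₂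
κ Is𝔣𝔦𝔭⟨ ℐ , 𝒥 , ℱ ⟩ = κ IsMinimumOf λ μ →
  (∃[ 𝒜 ] μ ≈ᶜ ∣ 𝒜 ∣ × (𝒥 ⁺-FIP) 𝒜 ×
    ¬ (∀ f → f ∈ ℱ → ∃[ B ] B ∈ ℐ × (𝒥 ⁺-FIP) (𝒜 ∪ (_≐ (f ⊢ B)))))
  ⊎ μ IsSuccessorOf 𝔠

{-# OPTIONS --safe #-}

-- Let 𝒜 have 𝒥⁺-FIP and let ⟨ 𝒜 ⟩ be the filter it generates.
--
-- (1) If B is a 𝒥⁺-pseudointersection of 𝒜 and f ∈ ℱ, some I ∈ ℐ has
-- f⁻¹[I] ∩ B ∉ 𝒥, and f⁻¹[I] can be added to 𝒜 because B is almost contained,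
-- modulo 𝒥, in every member of ⟨ 𝒜 ⟩.
--
-- (2) Call C good for X when every D ∈ ℐ with C ⊆* D has f⁻¹[D] ∩ X ∉ 𝒥.
-- Unless a single fibre of f meets every X ∈ ⟨ 𝒜 ⟩ in a 𝒥-positive set, every
-- X ∈ ⟨ 𝒜 ⟩ has a good C ∈ ℐ: if infinitely many fibres are positive on X, take
-- C ∈ ℐ to be an infinite set of such values; otherwise shrink X until no fibre
-- is positive, and use ℐ ≰ 𝒥 ↾ X.  If |𝒜| < add*(ℐ), one C is then good for
-- all X.  Instead of |𝒜^{<ω}| = |𝒜|, the proof bounds n-fold intersections by
-- applying |𝒜| < add*(ℐ) n times, and then all n at once because ω ≤ |𝒜|,
-- unless 𝒜 has a finite subfamily whose intersection is below all of 𝒜.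

module Submission where

open import Defs
open import Level using (0ℓ; Lift; lift; lower) renaming (suc to lsuc)
open import Axiom.ExcludedMiddle using (ExcludedMiddle)
open import Data.Empty using (⊥-elim)
open import Data.List.Base using (List; []; _∷_; _++_; filter; length)
open import Data.List.Membership.Propositional using () renaming (_∈_ to _∈ₗ_)
open import Data.List.Membership.Propositional.Properties
  using (∈-++⁺ˡ; ∈-++⁺ʳ; ∈-++⁻; ∈-filter⁺; ∈-filter⁻)
open import Data.List.Relation.Unary.All using (All; []; _∷_)
open import Data.List.Relation.Unary.All.Properties using (++⁺)
open import Data.List.Relation.Unary.Any using (here; there)
open import Data.Nat.Base using (ℕ; zero; suc; _<_; _≤′_; ≤′-refl; ≤′-step)
open import Data.Nat.Properties using (<-cmp; ≤⇒≤′)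
open import Data.Product.Base using (Σ; _×_; _,_; ∃-syntax; proj₁; proj₂; map₂)
open import Data.Sum.Base using (inj₁; inj₂; [_,_]′)
open import Data.Unit.Base using (tt)
open import Function.Base using (_∘_; id)
open import Function.Bundles using (Func)
import Function.Construct.Composition as Composition
import Function.Construct.Identity as Identity
import Function.Construct.Symmetry as Symmetry
open import Function.Properties.Inverse using (Inverse⇒Injection)
open import Relation.Binary.Bundles using (Setoid)
open import Relation.Binary.Definitions using (tri<; tri≈; tri>)
import Relation.Binary.Construct.On as On
open import Relation.Binary.PropositionalEquality as ≡ using (_≡_; refl)
open import Relation.Nullary.Decidable
  using (Dec; yes; no; map′; decidable-stable; toWitness; fromWitness; True)
open import Relation.Nullary.Negation.Core using (¬_)
open import Relation.Unary
  using (Pred; _∈_; _∉_; _⊆_; _≐_; _∩_; _∪_; _∖_; _⊢_; U; ｛_｝; Satisfiable)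

-- Almost inclusion and finite sets.

infix 4 _⊆*_

_⊆*_ : Subset → Subset → Set
A ⊆* B = Finite (A ∖ B)

⊆⇒⊆* : ∀ {A B} → A ⊆ B → A ⊆* B
⊆⇒⊆* A⊆B = [] , (λ (a , ¬b) → ⊥-elim (¬b (A⊆B a))) , λ ()

finite-｛｝ : ∀ n → Finite ｛ n ｝
finite-｛｝ n = n ∷ [] , (λ { refl → here refl }) , λ { (here refl) → refl }

finite-∪ : ∀ {A B} → Finite A → Finite B → Finite (A ∪ B)
finite-∪ (xs , A⊆xs , xs⊆A) (ys , B⊆ys , ys⊆B) =
  xs ++ ys ,
  [ ∈-++⁺ˡ ∘ A⊆xs , ∈-++⁺ʳ xs ∘ B⊆ys ]′ ,
  λ n∈ → [ inj₁ ∘ xs⊆A , inj₂ ∘ ys⊆B ]′ (∈-++⁻ xs n∈)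

-- The generated filter and adjoining one set to it.

⟨_⟩ : Family → Family
⟨ 𝒜 ⟩ X = ∃[ As ] All 𝒜 As × ⋂ₗ As ⊆ X

⋂ₗ-++ : ∀ As {Bs} → ⋂ₗ (As ++ Bs) ⊆ ⋂ₗ As ∩ ⋂ₗ Bs
⋂ₗ-++ []       n∈       = tt , n∈
⋂ₗ-++ (A ∷ As) (a , n∈) = let as , bs = ⋂ₗ-++ As n∈ in (a , as) , bs

module _ {𝒜 : Family} where

  U∈⟨⟩ : U ∈ ⟨ 𝒜 ⟩
  U∈⟨⟩ = [] , [] , id

  ∈⟨⟩ : ∀ {A} → A ∈ 𝒜 → A ∈ ⟨ 𝒜 ⟩
  ∈⟨⟩ A∈𝒜 = _ ∷ [] , A∈𝒜 ∷ [] , proj₁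

  ∩∈⟨⟩ : ∀ {X Y} → X ∈ ⟨ 𝒜 ⟩ → Y ∈ ⟨ 𝒜 ⟩ → X ∩ Y ∈ ⟨ 𝒜 ⟩
  ∩∈⟨⟩ (As , As⊆𝒜 , ⋂As⊆X) (Bs , Bs⊆𝒜 , ⋂Bs⊆Y) =
    As ++ Bs , ++⁺ As⊆𝒜 Bs⊆𝒜 ,
    λ n∈ → let as , bs = ⋂ₗ-++ As n∈ in ⋂As⊆X as , ⋂Bs⊆Y bs

  -- All copies of `D` in the list collapse to one, and the members taken from `𝒜` meet in `X`.
  -- Adjoining `D` therefore only requires each `D ∩ X` to be positive.
  ⟨⟩-∪ : ∀ {D : Subset} As → All (𝒜 ∪ (_≐ D)) As → ∃[ X ] X ∈ ⟨ 𝒜 ⟩ × X ∩ D ⊆ ⋂ₗ As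
  ⟨⟩-∪ []       []                = U , U∈⟨⟩ , λ _ → tt
  ⟨⟩-∪ (A ∷ As) (inj₁ A∈𝒜 ∷ As⊆) =
    let X , X∈ , X∩D⊆ = ⟨⟩-∪ As As⊆ in
    A ∩ X , ∩∈⟨⟩ (∈⟨⟩ A∈𝒜) X∈ , λ ((a , x) , d) → a , X∩D⊆ (x , d)
  ⟨⟩-∪ (A ∷ As) (inj₂ (_ , D⊆A) ∷ As⊆) =
    let X , X∈ , X∩D⊆ = ⟨⟩-∪ As As⊆ in
    X , X∈ , λ (x , d) → D⊆A d , X∩D⊆ (x , d)

  ⟨⟩-least : ∀ {X : Subset} → (∀ A → A ∈ 𝒜 → X ⊆ A) → ∀ {Y} → Y ∈ ⟨ 𝒜 ⟩ → X ⊆ Y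
  ⟨⟩-least {X} X⊆ (As , As⊆𝒜 , ⋂As⊆Y) = ⋂As⊆Y ∘ below As⊆𝒜
    where
    below : ∀ {As} → All 𝒜 As → X ⊆ ⋂ₗ As
    below []            _ = tt
    below (A∈𝒜 ∷ As⊆𝒜) x = X⊆ _ A∈𝒜 x , below As⊆𝒜 x

module _ {𝒜 𝒥 : Family} (ideal : IsIdeal 𝒥) where
  open IsIdeal ideal

  FIP⇒⟨⟩-positive : (𝒥 ⁺-FIP) 𝒜 → ∀ {X} → X ∈ ⟨ 𝒜 ⟩ → X ∉ 𝒥
  FIP⇒⟨⟩-positive (_ , fip) (As , As⊆𝒜 , ⋂As⊆X) X∈𝒥 = fip As As⊆𝒜 (⊆-closed ⋂As⊆X X∈𝒥)

  FIP-∪ : ∀ {D} → (∀ {X} → X ∈ ⟨ 𝒜 ⟩ → D ∩ X ∉ 𝒥) → (𝒥 ⁺-FIP) (𝒜 ∪ (_≐ D))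
  FIP-∪ {D} positive = (D , inj₂ (id , id)) , λ As As⊆ ⋂As∈𝒥 →
    let X , X∈ , X∩D⊆ = ⟨⟩-∪ As As⊆ in
    positive X∈ (⊆-closed (λ (d , x) → X∩D⊆ (x , d)) ⋂As∈𝒥)

finite-preimage : ∀ {𝒥 f Y} → IsIdeal 𝒥 → (∀ m → (f ⊢ ｛ m ｝) ∩ Y ∈ 𝒥) →
                  (xs : List ℕ) → (f ⊢ (_∈ₗ xs)) ∩ Y ∈ 𝒥
finite-preimage ideal fibre []       = IsIdeal.finite∈ ideal ([] , (λ ()) , λ ())
finite-preimage ideal fibre (x ∷ xs) = ⊆-closed
  (λ { (here fn≡x , y) → inj₁ (≡.sym fn≡x , y) ; (there fn∈ , y) → inj₂ (fn∈ , y) })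
  (∪-closed (fibre x) (finite-preimage ideal fibre xs))
  where open IsIdeal ideal

-- Cardinal comparisons.

ω : Cardinal
ω = On.setoid {B = Lift (lsuc 0ℓ) ℕ} (≡.setoid ℕ) lower

∣𝒜∣≤𝔠 : ∀ 𝒜 → ∣ 𝒜 ∣ ≤ᶜ 𝔠
∣𝒜∣≤𝔠 𝒜 = record { to = proj₁ ; cong = id ; injective = id }

≤ᶜ-≈ᶜ-trans : ∀ {κ μ ν} → κ ≤ᶜ μ → ν ≈ᶜ μ → κ ≤ᶜ ν
≤ᶜ-≈ᶜ-trans κ≤μ ν≈μ = Composition.injection κ≤μ (Inverse⇒Injection (Symmetry.inverse ν≈μ))

module _ (em : ExcludedMiddle (lsuc 0ℓ)) where

  em₀ : {P : Set} → Dec P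
  em₀ = map′ lower lift em

  finite-⊆ : ∀ {A B} → A ⊆ B → Finite B → Finite A
  finite-⊆ {A} A⊆B (xs , B⊆xs , _) =
    filter A? xs , (λ a → ∈-filter⁺ A? (B⊆xs (A⊆B a)) a) , λ n∈ → proj₂ (∈-filter⁻ A? {xs = xs} n∈)
    where
    A? : ∀ n → Dec (A n)
    A? n = em₀

  ⊆*-trans : ∀ {A B C} → A ⊆* B → B ⊆* C → A ⊆* C
  ⊆*-trans {A} {B} {C} A⊆*B B⊆*C = finite-⊆ split (finite-∪ A⊆*B B⊆*C)
    where
    split : A ∖ C ⊆ (A ∖ B) ∪ (B ∖ C)
    split {n} (a , ¬c) with em₀ {B n}
    ... | yes b = inj₂ (b , ¬c)
    ... | no ¬b = inj₁ (a , ¬b)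

  ∩-positive : ∀ {𝒥 A B C} → IsIdeal 𝒥 → A ∩ B ∉ 𝒥 → B ∖ C ∈ 𝒥 → A ∩ C ∉ 𝒥
  ∩-positive {𝒥} {A} {B} {C} ideal A∩B∉ B∖C∈ A∩C∈ =
    A∩B∉ (⊆-closed split (∪-closed A∩C∈ B∖C∈))
    where
    open IsIdeal ideal
    split : A ∩ B ⊆ (A ∩ C) ∪ (B ∖ C)
    split {n} (a , b) with em₀ {C n}
    ... | yes c = inj₁ (a , c)
    ... | no ¬c = inj₂ (b , ¬c)

  module _ {𝒜 𝒥 : Family} (ideal : IsIdeal 𝒥) where
    open IsIdeal ideal

    pseudointersection-∖ : ∀ {B} → (𝒥 ⁺-Pseudointersection 𝒜) B →
                           ∀ {X} → X ∈ ⟨ 𝒜 ⟩ → B ∖ X ∈ 𝒥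
    pseudointersection-∖ {B} (_ , B∖) (As , As⊆𝒜 , ⋂As⊆X) =
      ⊆-closed (λ (b , ¬x) → b , ¬x ∘ ⋂As⊆X) (go As As⊆𝒜)
      where
      go : ∀ As → All 𝒜 As → B ∖ ⋂ₗ As ∈ 𝒥
      go []       []            = finite∈ ([] , (λ (_ , ¬tt) → ⊥-elim (¬tt tt)) , λ ())
      go (A ∷ As) (A∈𝒜 ∷ As⊆𝒜) = ⊆-closed split (∪-closed (B∖ A A∈𝒜) (go As As⊆𝒜))
        where
        split : B ∖ (A ∩ ⋂ₗ As) ⊆ (B ∖ A) ∪ (B ∖ ⋂ₗ As)
        split {n} (b , ¬a∩as) with em₀ {A n}
        ... | yes a = inj₂ (b , λ as → ¬a∩as (a , as))
        ... | no ¬a = inj₁ (b , ¬a)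

  -- Pseudointersections and the bound by `𝔭`.

  module _ {ℱ : Pred (ℕ → ℕ) (lsuc 0ℓ)} {ℐ 𝒥 : Family}
           (idealℐ : IsIdeal ℐ) (ideal𝒥 : IsIdeal 𝒥) (tall : Tall ℐ)
           (≰ : ∀ A → A ∉ 𝒥 → ¬ (ℐ ≤[ ℱ ] 𝒥 ↾ A)) where

    positive-preimage : ∀ {f A} → f ∈ ℱ → A ∉ 𝒥 → ∃[ B ] B ∈ ℐ × (f ⊢ B) ∩ A ∉ 𝒥
    positive-preimage f∈ℱ A∉𝒥 = decidable-stable em λ none →
      ≰ _ A∉𝒥 (_ , f∈ℱ , λ B B∈ℐ → decidable-stable em λ ∉𝒥 → none (B , B∈ℐ , ∉𝒥))

    Extends : Family → Set₁
    Extends 𝒜 = ∀ f → f ∈ ℱ → ∃[ B ] B ∈ ℐ × (𝒥 ⁺-FIP) (𝒜 ∪ (_≐ (f ⊢ B)))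

    pseudointersection⇒extends :
      ∀ {𝒜} → Satisfiable (𝒥 ⁺-Pseudointersection 𝒜) → Extends 𝒜
    pseudointersection⇒extends (B , pseudo@(B∉𝒥 , _)) f f∈ℱ =
      let I , I∈ℐ , f⁻¹I∩B∉𝒥 = positive-preimage f∈ℱ B∉𝒥 in
      I , I∈ℐ , FIP-∪ ideal𝒥 λ X∈ →
        ∩-positive ideal𝒥 f⁻¹I∩B∉𝒥 (pseudointersection-∖ ideal𝒥 pseudo X∈)

    -- Every cardinal competing for `𝔣𝔦𝔭` also competes for `𝔭`: the successor clause is shared, and
    -- a family that fails to extend has no pseudointersection.
    𝔭≤𝔣𝔦𝔭 : ∀ κ μ → κ Is𝔭 𝒥 → μ Is𝔣𝔦𝔭⟨ ℐ , 𝒥 , ℱ ⟩ → κ ≤ᶜ μ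
    𝔭≤𝔣𝔦𝔭 κ μ (_ , κ-min) (inj₂ μ-succ , _) = κ-min μ (inj₂ μ-succ)
    𝔭≤𝔣𝔦𝔭 κ μ (_ , κ-min) (inj₁ (𝒜 , μ≈𝒜 , fip , ¬extends) , _) =
      κ-min μ (inj₁ (𝒜 , μ≈𝒜 , fip , ¬extends ∘ pseudointersection⇒extends))

    -- Good sets for a single member of the filter.

    Good : (ℕ → ℕ) → Subset → Subset → Set₁
    Good f X C = ∀ D → D ∈ ℐ → C ⊆* D → (f ⊢ D) ∩ X ∉ 𝒥

    module _ {𝒜 : Family} (fip : (𝒥 ⁺-FIP) 𝒜) {f : ℕ → ℕ} (f∈ℱ : f ∈ ℱ)
             (null : ∀ n → ∃[ X ] X ∈ ⟨ 𝒜 ⟩ × (f ⊢ ｛ n ｝) ∩ X ∈ 𝒥) where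
      open IsIdeal ideal𝒥

      -- Membership in 𝒥 lives in Set₁, so excluded middle is used to bring this
      -- set of naturals down to Set.
      PositiveFibres : Subset → Subset
      PositiveFibres X n = True (em {(f ⊢ ｛ n ｝) ∩ X ∉ 𝒥})

      -- If `f⁻¹[D] ∩ X` were null, `D` would contain no value with a positive fibre. Then `C` would
      -- be disjoint from `D`, and `C ⊆* D` would make `C` finite.
      good-infinite : ∀ {X} → Infinite (PositiveFibres X) → ∃[ C ] C ∈ ℐ × Good f X C
      good-infinite infinite =
        let C , C⊆ , C-infinite , C∈ℐ = tall _ infinite in
        C , C∈ℐ , λ D _ (xs , C∖D≐xs) f⁻¹D∩X∈𝒥 →
          let disjoint : ∀ {n} → n ∈ C → n ∉ D
              disjoint c d = toWitness (C⊆ c) (⊆-closed (λ { (refl , x) → d , x }) f⁻¹D∩X∈𝒥)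
          in C-infinite (xs , (λ c → proj₁ C∖D≐xs (c , disjoint c)) , proj₁ ∘ proj₂ C∖D≐xs)

      -- Passing from `C` to `D` loses finitely many values, hence on `Y` a finite union of null
      -- fibres, so `f⁻¹[D]` stays positive on `Y` and on `X`.
      good-null : ∀ {X Y} → Y ∈ ⟨ 𝒜 ⟩ → Y ⊆ X → (∀ m → (f ⊢ ｛ m ｝) ∩ Y ∈ 𝒥) →
                  ∃[ C ] C ∈ ℐ × Good f X C
      good-null {X} {Y} Y∈ Y⊆X fibre =
        let C , C∈ℐ , f⁻¹C∩Y∉𝒥 = positive-preimage f∈ℱ (FIP⇒⟨⟩-positive ideal𝒥 fip Y∈) in
        C , C∈ℐ , λ D _ (xs , C∖D⊆xs , _) f⁻¹D∩X∈𝒥 →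
          ∩-positive {A = Y} {B = (f ⊢ C) ∩ Y} {C = f ⊢ D} ideal𝒥
            (f⁻¹C∩Y∉𝒥 ∘ ⊆-closed λ (c , y) → y , c , y)
            (⊆-closed (λ ((c , y) , ¬d) → C∖D⊆xs (c , ¬d) , y)
              (finite-preimage ideal𝒥 fibre xs))
            (⊆-closed (λ (y , d) → d , Y⊆X y) f⁻¹D∩X∈𝒥)

      null-on : ∀ xs → ∃[ Y ] Y ∈ ⟨ 𝒜 ⟩ × (∀ m → m ∈ₗ xs → (f ⊢ ｛ m ｝) ∩ Y ∈ 𝒥)
      null-on []       = U , U∈⟨⟩ , λ _ ()
      null-on (x ∷ xs) =
        let Y , Y∈ , Y-null = null-on xs
            A , A∈ , A-null = null x
        in A ∩ Y , ∩∈⟨⟩ A∈ Y∈ , λ where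
             _ (here refl) → ⊆-closed (λ (e , a , _) → e , a) A-null
             m (there m∈)  → ⊆-closed (λ (e , _ , y) → e , y) (Y-null m m∈)

      good : ∀ {X} → X ∈ ⟨ 𝒜 ⟩ → ∃[ C ] C ∈ ℐ × Good f X C
      good {X} X∈ with em₀ {Finite (PositiveFibres X)}
      ... | no infinite = good-infinite infinite
      ... | yes (xs , positive⊆xs , _) =
        -- Only the fibres over `xs` are positive on `X`, and `Y` makes these null, so every fibre
        -- is null on `X ∩ Y`.
        let Y , Y∈ , Y-null = null-on xs in
        good-null (∩∈⟨⟩ X∈ Y∈) proj₁ (fibre Y-null)
        where
        fibre : ∀ {Y} → (∀ m → m ∈ₗ xs → (f ⊢ ｛ m ｝) ∩ Y ∈ 𝒥) →
                ∀ m → (f ⊢ ｛ m ｝) ∩ (X ∩ Y) ∈ 𝒥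
        fibre Y-null m with em {(f ⊢ ｛ m ｝) ∩ X ∈ 𝒥}
        ... | yes X-null = ⊆-closed (λ (e , x , _) → e , x) X-null
        ... | no ¬null   =
          ⊆-closed (λ (e , _ , y) → e , y) (Y-null m (positive⊆xs (fromWitness ¬null)))

    -- Choice and bounds obtained from `add*`.

    module _ (ac : AxiomOfChoice (lsuc 0ℓ) 0ℓ (lsuc 0ℓ)) where

      Image : ∀ {S : Cardinal} → Func S ∣ ℐ ∣ → Family
      Image {S} g D = Σ (Setoid.Carrier S) λ s → D ≐ proj₁ (Func.to g s)

      -- The index stored in a membership proof need not respect `≐`, so `ac` selects one that does.
      -- An index determines its set, which gives injectivity.
      ∣Image∣≤ : ∀ {S} (g : Func S ∣ ℐ ∣) → ∣ Image g ∣ ≤ᶜ S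
      ∣Image∣≤ {S} g =
        let h , spec = ac ∣ Image g ∣ S (λ D s → Lift _ (proj₁ D ≐ proj₁ (Func.to g s)))
              (λ D≐D′ s≈s′ (lift D≐) →
                 lift (≐.trans (≐.sym D≐D′) (≐.trans D≐ (Func.cong g s≈s′))))
              (λ (D , s , D≐) → s , lift D≐)
        in record
          { to        = Func.to h
          ; cong      = Func.cong h
          ; injective = λ hx≈hy →
              ≐.trans (lower (spec _)) (≐.trans (Func.cong g hx≈hy) (≐.sym (lower (spec _))))
          }
        where module ≐ = Setoid 𝔠

      -- Choose one `C` for each `s`. Were the chosen sets unbounded in `ℐ`, minimality of `κ` would
      -- give `κ ≤ᶜ ∣ Image g ∣ ≤ᶜ S`. A bound inherits each `R s` by `R-mono`.
      add*-bound : ∀ {κ S} → κ IsAdd* ℐ → ¬ (κ ≤ᶜ S) →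
        (R : Setoid.Carrier S → Subset → Set₁) →
        (∀ {s t C} → Setoid._≈_ S s t → R s C → R t C) →
        (∀ {s C D} → C ⊆* D → R s C → R s D) →
        (∀ s → ∃[ C ] C ∈ ℐ × R s C) →
        ∃[ C ] C ∈ ℐ × (∀ s → R s C)
      add*-bound {κ} {S} (_ , κ-min) κ≰S R R-resp R-mono total =
        let g , spec = ac S ∣ ℐ ∣ (λ s C → R s (proj₁ C))
              (λ s≈t C≐D → R-mono (⊆⇒⊆* (proj₁ C≐D)) ∘ R-resp s≈t)
              (λ s → let C , C∈ℐ , r = total s in (C , C∈ℐ) , r)
            C , C∈ℐ , bound = decidable-stable (em {∃[ C ] C ∈ ℐ × (∀ D → D ∈ Image g → D ⊆* C)})
              λ unbounded → κ≰S (Composition.injection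
                (κ-min ∣ Image g ∣
                  ( Image g , Identity.inverse _
                  , (λ (s , D≐) → IsIdeal.⊆-closed idealℐ (proj₁ D≐) (proj₂ (Func.to g s)))
                  , unbounded))
                (∣Image∣≤ g))
        in C , C∈ℐ , λ s → R-mono (bound _ (s , id , id)) (spec s)

      -- Each `term n` is a member of `𝒜` that does not contain `meet n`, the intersection of the
      -- earlier terms. Every earlier term does contain it, so the terms are distinct.
      ω≤∣𝒜∣ : ∀ {𝒜} → ¬ (∃[ X ] X ∈ ⟨ 𝒜 ⟩ × (∀ A → A ∈ 𝒜 → X ⊆ A)) → ω ≤ᶜ ∣ 𝒜 ∣
      ω≤∣𝒜∣ {𝒜} no-least = record
        { to        = λ n → Func.to next (meet (lower n))
        ; cong      = λ { {m} {n} refl → ≐.refl {proj₁ (Func.to next (meet (lower m)))} }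
        ; injective = λ {m} {n} → injective (lower m) (lower n)
        }
        where
        module ≐ = Setoid 𝔠

        choice : Σ (Func ∣ ⟨ 𝒜 ⟩ ∣ ∣ 𝒜 ∣) λ next →
                 ∀ X → Lift (lsuc 0ℓ) (¬ (proj₁ X ⊆ proj₁ (Func.to next X)))
        choice = ac ∣ ⟨ 𝒜 ⟩ ∣ ∣ 𝒜 ∣ (λ X A → Lift _ (¬ (proj₁ X ⊆ proj₁ A)))
          (λ X≐X′ A≐A′ (lift X⊈A) → lift λ X′⊆A′ →
             X⊈A (λ x → proj₂ A≐A′ (X′⊆A′ (proj₁ X≐X′ x))))
          (λ (X , X∈) → decidable-stable em λ none → no-least (X , X∈ , λ A A∈𝒜 x →
             decidable-stable em₀ λ n∉A → none ((A , A∈𝒜) , lift λ X⊆A → n∉A (X⊆A x))))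

        next : Func ∣ ⟨ 𝒜 ⟩ ∣ ∣ 𝒜 ∣
        next = proj₁ choice

        meet : ℕ → Σ Subset ⟨ 𝒜 ⟩
        meet zero    = U , U∈⟨⟩
        meet (suc n) =
          let X , X∈ = meet n ; A , A∈𝒜 = Func.to next (meet n) in
          X ∩ A , ∩∈⟨⟩ X∈ (∈⟨⟩ A∈𝒜)

        term : ℕ → Subset
        term n = proj₁ (Func.to next (meet n))

        meet⊆term : ∀ {m n} → suc m ≤′ n → proj₁ (meet n) ⊆ term m
        meet⊆term ≤′-refl       = proj₂
        meet⊆term (≤′-step m<n) = meet⊆term m<n ∘ proj₁

        distinct : ∀ {m n} → m < n → ¬ (term m ⊆ term n)
        distinct m<n m⊆n = lower (proj₂ choice (meet _)) (m⊆n ∘ meet⊆term (≤⇒≤′ m<n))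

        injective : ∀ m n → term m ≐ term n → m ≡ n
        injective m n m≐n with <-cmp m n
        ... | tri< m<n _ _ = ⊥-elim (distinct m<n (proj₁ m≐n))
        ... | tri≈ _ m≡n _ = m≡n
        ... | tri> _ _ n<m = ⊥-elim (distinct n<m (proj₂ m≐n))

      -- One good set for the whole filter.

      module _ {κ : Cardinal} (κ-add* : κ IsAdd* ℐ) {𝒜 : Family} (fip : (𝒥 ⁺-FIP) 𝒜)
               (κ≰𝒜 : ¬ (κ ≤ᶜ ∣ 𝒜 ∣)) {f : ℕ → ℕ} (f∈ℱ : f ∈ ℱ) where
        open IsIdeal ideal𝒥

        -- The recursion adds one member of `𝒜` per level, so that each level is a quantification
        -- over `𝒜` alone, to which `κ≰𝒜` applies.
        GoodBelow : ℕ → Subset → Subset → Set₁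
        GoodBelow zero    X C = Good f X C
        GoodBelow (suc n) X C = ∀ A → A ∈ 𝒜 → GoodBelow n (X ∩ A) C

        GoodBelow-⊆ : ∀ n {X Y C} → X ⊆ Y → GoodBelow n X C → GoodBelow n Y C
        GoodBelow-⊆ zero    X⊆Y g D D∈ℐ C⊆*D = g D D∈ℐ C⊆*D ∘ ⊆-closed (map₂ X⊆Y)
        GoodBelow-⊆ (suc n) X⊆Y g A A∈𝒜 =
          GoodBelow-⊆ n (λ (x , a) → X⊆Y x , a) (g A A∈𝒜)

        -- The quantifier over `D` in `Good` serves this monotonicity, which lets an almost-upper
        -- bound inherit goodness.
        GoodBelow-⊆* : ∀ n {X C D} → C ⊆* D → GoodBelow n X C → GoodBelow n X D
        GoodBelow-⊆* zero    C⊆*D g E E∈ℐ D⊆*E = g E E∈ℐ (⊆*-trans C⊆*D D⊆*E)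
        GoodBelow-⊆* (suc n) C⊆*D g A A∈𝒜      = GoodBelow-⊆* n C⊆*D (g A A∈𝒜)

        GoodBelow-⋂ₗ : ∀ {X C As} → All 𝒜 As → GoodBelow (length As) X C → Good f (X ∩ ⋂ₗ As) C
        GoodBelow-⋂ₗ []            g = GoodBelow-⊆ zero (λ x → x , tt) g
        GoodBelow-⋂ₗ (A∈𝒜 ∷ As⊆𝒜) g =
          GoodBelow-⊆ zero (λ ((x , a) , as) → x , a , as) (GoodBelow-⋂ₗ As⊆𝒜 (g _ A∈𝒜))

        goodBelow : (∀ {X} → X ∈ ⟨ 𝒜 ⟩ → ∃[ C ] C ∈ ℐ × Good f X C) →
                    ∀ n {X} → X ∈ ⟨ 𝒜 ⟩ → ∃[ C ] C ∈ ℐ × GoodBelow n X C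
        goodBelow good-∃ zero        X∈ = good-∃ X∈
        goodBelow good-∃ (suc n) {X} X∈ =
          let C , C∈ℐ , g = add*-bound {S = ∣ 𝒜 ∣} κ-add* κ≰𝒜
                (λ A → GoodBelow n (X ∩ proj₁ A))
                (λ A≐B → GoodBelow-⊆ n (map₂ (proj₁ A≐B)))
                (GoodBelow-⊆* n)
                (λ (A , A∈𝒜) → goodBelow good-∃ n (∩∈⟨⟩ X∈ (∈⟨⟩ A∈𝒜)))
          in C , C∈ℐ , λ A A∈𝒜 → g (A , A∈𝒜)

        uniformly-good : ω ≤ᶜ ∣ 𝒜 ∣ → (∀ {X} → X ∈ ⟨ 𝒜 ⟩ → ∃[ C ] C ∈ ℐ × Good f X C) →
                         ∃[ C ] C ∈ ℐ × (∀ {X} → X ∈ ⟨ 𝒜 ⟩ → Good f X C)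
        uniformly-good ω≤𝒜 good-∃ =
          let C , C∈ℐ , g = add*-bound {S = ω} κ-add*
                (λ κ≤ω → κ≰𝒜 (Composition.injection κ≤ω ω≤𝒜))
                (λ n → GoodBelow (lower n) U)
                (λ { refl → id })
                (λ {n} → GoodBelow-⊆* (lower n))
                (λ n → goodBelow good-∃ (lower n) U∈⟨⟩)
          in C , C∈ℐ , λ (As , As⊆𝒜 , ⋂As⊆X) →
               -- The level is the length of the list: starting from `U`, each member of `As` uses
               -- up one level.
               GoodBelow-⊆ zero (⋂As⊆X ∘ proj₂) (GoodBelow-⋂ₗ As⊆𝒜 (g (lift (length As))))

        extension : ∃[ B ] B ∈ ℐ × (𝒥 ⁺-FIP) (𝒜 ∪ (_≐ (f ⊢ B)))
        extension
          with em {∃[ X ] X ∈ ⟨ 𝒜 ⟩ × (∀ A → A ∈ 𝒜 → X ⊆ A)}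
             | em {∃[ n ] (∀ X → X ∈ ⟨ 𝒜 ⟩ → (f ⊢ ｛ n ｝) ∩ X ∉ 𝒥)}
        -- `X` lies below the whole filter, so a preimage positive on `X` is positive on all its
        -- members. Excluding this case makes `𝒜` infinite.
        ... | yes (X , X∈ , X-least) | _ =
          let B , B∈ℐ , f⁻¹B∩X∉𝒥 = positive-preimage f∈ℱ (FIP⇒⟨⟩-positive ideal𝒥 fip X∈) in
          B , B∈ℐ , FIP-∪ ideal𝒥 λ Y∈ →
            f⁻¹B∩X∉𝒥 ∘ ⊆-closed (map₂ (⟨⟩-least X-least Y∈))
        ... | no _ | yes (n , positive) =
          ｛ n ｝ , IsIdeal.finite∈ idealℐ (finite-｛｝ n) , FIP-∪ ideal𝒥 (positive _)
        ... | no no-least | no no-positive =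
          let C , C∈ℐ , g = uniformly-good (ω≤∣𝒜∣ no-least) (good fip f∈ℱ null) in
          C , C∈ℐ , FIP-∪ ideal𝒥 λ X∈ → g X∈ C C∈ℐ (⊆⇒⊆* id)
          where
          null : ∀ n → ∃[ X ] X ∈ ⟨ 𝒜 ⟩ × (f ⊢ ｛ n ｝) ∩ X ∈ 𝒥
          null n = decidable-stable em λ none →
            no-positive (n , λ X X∈ X-null → none (X , X∈ , X-null))

      add*≤𝔣𝔦𝔭 : ∀ κ μ → κ IsAdd* ℐ → μ Is𝔣𝔦𝔭⟨ ℐ , 𝒥 , ℱ ⟩ → κ ≤ᶜ μ
      -- `κ` is the size of a family of subsets of ω, hence at most `𝔠`.
      add*≤𝔣𝔦𝔭 κ μ ((ℬ , κ≈ℬ , _) , _) (inj₂ ((𝔠≤μ , _) , _) , _) =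
        Composition.injection (Inverse⇒Injection κ≈ℬ) (Composition.injection (∣𝒜∣≤𝔠 ℬ) 𝔠≤μ)
      add*≤𝔣𝔦𝔭 κ μ κ-add* (inj₁ (𝒜 , μ≈𝒜 , fip , ¬extends) , _) = decidable-stable em λ κ≰μ →
        ¬extends λ f f∈ℱ →
          extension κ-add* fip (λ κ≤𝒜 → κ≰μ (≤ᶜ-≈ᶜ-trans κ≤𝒜 μ≈𝒜)) f∈ℱ

theorem4p1 : ExcludedMiddle (lsuc 0ℓ) →
    AxiomOfChoice (lsuc 0ℓ) 0ℓ (lsuc 0ℓ) →
    (ℱ : Pred (ℕ → ℕ) (lsuc 0ℓ)) (ℐ 𝒥 : Family) →
    IsIdeal ℐ → IsIdeal 𝒥 →
    Tall ℐ →
    (∀ A → A ∉ 𝒥 → ¬ (ℐ ≤[ ℱ ] 𝒥 ↾ A)) →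
    (∀ κ μ → κ Is𝔭 𝒥 → μ Is𝔣𝔦𝔭⟨ ℐ , 𝒥 , ℱ ⟩ → κ ≤ᶜ μ)
    × (∀ κ μ → κ IsAdd* ℐ → μ Is𝔣𝔦𝔭⟨ ℐ , 𝒥 , ℱ ⟩ → κ ≤ᶜ μ)
theorem4p1 em ac ℱ ℐ 𝒥 idealℐ ideal𝒥 tall ≰ =
  𝔭≤𝔣𝔦𝔭 em idealℐ ideal𝒥 tall ≰ , add*≤𝔣𝔦𝔭 em idealℐ ideal𝒥 tall ≰ ac
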